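{- If $H$ is a finite chordal graph with clique number $\omega(H)=3$, then $\chi_{\mathrm{g}}^{(2)}(H) \le 4$.
   Context: The $k$-clique-relaxed $n$-coloring game on a finite graph $G$: there is a fixed set of $n$ colors; Alice moves first, and Alice and Bob alternately choose an uncolored vertex and assign it one of the $n$ colors, subject to the rule that at no point may there be a monochromatic clique on $k+1$ vertices. Alice wins if the game ends with all vertices colored; Bob wins if at some point an uncolored vertex has no legal color. $\chi_{\mathrm{g}}^{(k)}(G)$ is the least $n$ such that Alice has a winning strategy. Here $k=2$, so the forbidden monochromatic cliques are triangles. A graph is chordal if it has no induced cycle of length at least 4. -}

module Defs where

open import Data.Nat using (ℕ; zero; suc; _≤_)
open import Data.Fin using (Fin; toℕ; _≟_)
open import Data.Bool using (Bool; true; false)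
open import Data.Maybe using (Maybe; just; nothing)
open import Data.Product using (Σ; ∃; _×_; _,_)
open import Data.Sum using (_⊎_)
open import Relation.Nullary using (¬_; yes; no)
open import Relation.Binary.PropositionalEquality using (_≡_)
open import Function.Definitions using (Injective)
open import Function.Bundles using (_⇔_)

record Graph : Set where
  field
    N     : ℕ
    adj   : Fin N → Fin N → Bool
    sym   : ∀ u v → adj u v ≡ adj v u
    irrefl : ∀ v → adj v v ≡ false

open Graph public

Edge : (G : Graph) → Fin (N G) → Fin (N G) → Set
Edge G u v = adj G u v ≡ true

HasClique : (G : Graph) → ℕ → Set
HasClique G k = Σ (Fin k → Fin (N G)) λ f →
  Injective _≡_ _≡_ f × (∀ i j → ¬ i ≡ j → Edge G (f i) (f j))

CliqueNumber : Graph → ℕ → Set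
CliqueNumber G w = HasClique G w × (∀ k → HasClique G k → k ≤ w)

CycAdj : (k : ℕ) → Fin k → Fin k → Set
CycAdj k i j =
  (suc (toℕ i) ≡ toℕ j) ⊎ (suc (toℕ j) ≡ toℕ i)
  ⊎ ((toℕ i ≡ 0 × suc (toℕ j) ≡ k) ⊎ (toℕ j ≡ 0 × suc (toℕ i) ≡ k))

InducedCycle : (G : Graph) → ℕ → Set
InducedCycle G k = Σ (Fin k → Fin (N G)) λ f →
  Injective _≡_ _≡_ f × (∀ i j → Edge G (f i) (f j) ⇔ CycAdj k i j)

Chordal : Graph → Set
Chordal G = ∀ k → 4 ≤ k → ¬ InducedCycle G k

Coloring : Graph → ℕ → Set
Coloring G n = Fin (N G) → Maybe (Fin n)

update : {G : Graph} {n : ℕ} → Coloring G n → Fin (N G) → Fin n → Coloring G n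
update {G} {n} s v c w with w ≟ v
... | yes _ = just c
... | no  _ = s w

-- k-clique-relaxed legality for k = 2: no monochromatic clique on 3 vertices.
Legal : (G : Graph) (n : ℕ) → Coloring G n → Set
Legal G n s = ∀ a b c (x : Fin n) →
  Edge G a b → Edge G b c → Edge G a c →
  s a ≡ just x → s b ≡ just x → s c ≡ just x → Data.Empty.⊥
  where import Data.Empty

Complete : (G : Graph) (n : ℕ) → Coloring G n → Set
Complete G n s = ∀ v → ¬ s v ≡ nothing

-- Every uncoloured vertex still has a legal colour (otherwise Bob has won).
AllColorable : (G : Graph) (n : ℕ) → Coloring G n → Set
AllColorable G n s = ∀ v → s v ≡ nothing → ∃ λ c → Legal G n (update {G} {n} s v c)

mutual
  data AliceWinsA (G : Graph) (n : ℕ) : Coloring G n → Set where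
    doneA : ∀ {s} → Complete G n s → AliceWinsA G n s
    moveA : ∀ {s} → AllColorable G n s →
            (v : Fin (N G)) (c : Fin n) → s v ≡ nothing →
            Legal G n (update {G} {n} s v c) → AliceWinsB G n (update {G} {n} s v c) →
            AliceWinsA G n s

  data AliceWinsB (G : Graph) (n : ℕ) : Coloring G n → Set where
    doneB : ∀ {s} → Complete G n s → AliceWinsB G n s
    moveB : ∀ {s} → AllColorable G n s →
            (∀ (v : Fin (N G)) (c : Fin n) → s v ≡ nothing →
               Legal G n (update {G} {n} s v c) → AliceWinsA G n (update {G} {n} s v c)) →
            AliceWinsB G n s

emptyColoring : (G : Graph) (n : ℕ) → Coloring G n
emptyColoring G n _ = nothing

AliceWins2 : Graph → ℕ → Set
AliceWins2 G n = AliceWinsA G n (emptyColoring G n)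

-- χ_g^{(2)}(G) ≤ m  : the least n for which Alice wins is ≤ m,
-- i.e. Alice wins for some n ≤ m.
GameChrom2≤ : Graph → ℕ → Set
GameChrom2≤ G m = Σ ℕ λ n → n ≤ m × AliceWins2 G n

{-# OPTIONS --safe #-}
module Submission where

-- A chordal graph has a perfect elimination ordering (Dirac); when ω = 3, every vertex has at most two
-- earlier neighbours, its parents, and they are adjacent. Alice plays Kierstead's activation strategy with four
-- colours: from the vertex b just coloured by Bob she repeatedly activates the current vertex and moves on to
-- its least uncoloured parent, until she meets an active vertex or one without uncoloured parents, which she
-- colours. A vertex is the target of at most two such moves, the second of which gets it coloured, and the
-- targets of the children of an uncoloured vertex u are parents of u or u itself. Hence at most 2 · 2
-- children of u are coloured, so, with its two parents and Bob's last vertex, u has at most seven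
-- coloured neighbours. A forbidden colour needs two neighbours of u in that colour, so one of the four
-- colours is always legal.

open import Defs
open import Data.Bool using (Bool; true; false)
open import Data.Bool.Properties using () renaming (_≟_ to _≟ᵇ_)
open import Data.Empty using (⊥; ⊥-elim)
open import Data.Fin using (Fin; zero; suc; toℕ; fromℕ; combine; remQuot; _≟_)
open import Data.Fin.Properties using (any?; toℕ-fromℕ; injective⇒≤; combine-remQuot; ¬∀⟶∃¬)
open import Data.Fin.Subset using (Subset; _∈_; _∉_; _⊂_; _-_; ⁅_⁆; ∣_∣; ⊤)
open import Data.Fin.Subset.Properties using (_∈?_; p⊂q⇒∣p∣<∣q∣; p─q⊆p; x∈p∧x≢y⇒x∈p-y; x∈p⇒p-x⊂p; ∈⊤)
open import Data.List using (List; []; _∷_; length; lookup)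
open import Data.List.Relation.Unary.All as All using (All; []; _∷_)
open import Data.List.Relation.Unary.Any as Any using (Any; here; there)
open import Data.List.Membership.Propositional.Properties using (∈-lookup)
open import Data.Maybe using (Maybe; just; nothing)
open import Data.Maybe.Properties using (just-injective; ≡-dec)
open import Data.Nat using (ℕ; zero; suc; _+_; _≤_; _<_; z≤n; s≤s; _<?_)
open import Data.Nat.Induction using (<-wellFounded)
open import Data.Nat.Properties using (≤-refl; <-irrefl; <-asym; ≮⇒≥; n<1+n; m<n⇒m<1+n; <-cmp; ≤∧≢⇒<; <⇒≱)
import Data.Nat.Properties as ℕ
open import Data.Product using (∃; ∃₂; _×_; _,_; proj₁; proj₂)
open import Data.Sum using (_⊎_; inj₁; inj₂; [_,_]′)
open import Data.Vec as Vec using (tabulate; []; _∷_)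
open import Data.Vec.Properties using (lookup∘tabulate; lookup⇒[]=; []=⇒lookup)
open import Function using (_∘_)
open import Function.Bundles using (mk⇔)
open import Induction.WellFounded using (Acc; acc; WellFounded; module Subrelation)
import Relation.Binary.Construct.On as On
open import Relation.Binary.Construct.Closure.ReflexiveTransitive using (Star; ε; _◅_; _◅◅_; reverse)
import Relation.Binary.Construct.Closure.ReflexiveTransitive as Star
open import Relation.Binary.Definitions using (tri<; tri≈; tri>)
open import Relation.Binary.PropositionalEquality using (_≡_; _≢_; refl; cong; trans; subst) renaming (sym to ≡-sym)
open import Relation.Nullary using (¬_; Dec; yes; no; does; contradiction)
open import Relation.Nullary.Decidable using (_×-dec_; _⊎-dec_; ¬?; dec-true; decidable-stable)
open import Relation.Unary using (Decidable)

-- Subsets of a finite set.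

module _ {n : ℕ} {P : Fin n → Set} (P? : Decidable P) where

  ⟪_⟫ : Subset n
  ⟪_⟫ = tabulate (does ∘ P?)

  ∈-comprehension⁺ : ∀ {x} → P x → x ∈ ⟪_⟫
  ∈-comprehension⁺ {x} px =
    lookup⇒[]= x _ (trans (lookup∘tabulate (does ∘ P?) x) (dec-true (P? x) px))

  ∈-comprehension⁻ : ∀ {x} → x ∈ ⟪_⟫ → P x
  ∈-comprehension⁻ {x} x∈ with P? x | trans (≡-sym (lookup∘tabulate (does ∘ P?) x)) ([]=⇒lookup x∈)
  ... | yes px | _ = px

⊂-wellFounded : ∀ {n} → WellFounded (_⊂_ {n})
⊂-wellFounded = Subrelation.wellFounded p⊂q⇒∣p∣<∣q∣ (On.wellFounded ∣_∣ <-wellFounded)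

-- Chordal graphs

module _ (G : Graph) where

  V : Set
  V = Fin (N G)

  E : V → V → Set
  E = Edge G

  E? : ∀ u v → Dec (E u v)
  E? u v = adj G u v ≟ᵇ true

  E-sym : ∀ {u v} → E u v → E v u
  E-sym {u} {v} e = trans (≡-sym (sym G u v)) e

  E-irrefl : ∀ {v} → ¬ E v v
  E-irrefl {v} e with trans (≡-sym e) (irrefl G v)
  ... | ()

  E⇒≢ : ∀ {u v} → E u v → u ≢ v
  E⇒≢ e refl = E-irrefl e

  -- Induced paths and cycles.

  -- IPath y x l: the vertices x ∷ l form, in this order, an induced path ending in y.
  data IPath (y : V) : V → List V → Set where
    end  : IPath y y []
    step : ∀ {x a l} → E x a → All (λ z → x ≢ z × ¬ E x z) l → IPath y a l → IPath y x (a ∷ l)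

  Meets : V → V → Set
  Meets x z = x ≡ z ⊎ E x z

  Meets? : ∀ x z → Dec (Meets x z)
  Meets? x z = x ≟ z ⊎-dec E? x z

  -- Jump from x to the last vertex of the path that meets x.
  extend : ∀ {Q : V → Set} {x y a l} → Q x → All Q (a ∷ l) → IPath y a l → Any (Meets x) (a ∷ l) →
           ∃ λ l′ → IPath y x l′ × All Q (x ∷ l′)
  extend {x = x} {l = l} qx (qa ∷ ql) p m with Any.any? (Meets? x) l
  extend {l = _ ∷ _} qx (qa ∷ ql) (step _ _ p) m | yes m′ = extend qx ql p m′
  extend {x = x} {a = a} {l = l} qx q@(qa ∷ ql) p (there m) | no ¬m = contradiction m ¬m
  extend {x = x} {a = a} {l = l} qx q@(qa ∷ ql) p (here (inj₁ refl)) | no ¬m = l , p , q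
  extend {x = x} {a = a} {l = l} qx q@(qa ∷ ql) p (here (inj₂ e)) | no ¬m =
    a ∷ l , step e (far l ¬m) p , qx ∷ q
    where
    far : ∀ l → ¬ Any (Meets x) l → All (λ z → x ≢ z × ¬ E x z) l
    far []      _  = []
    far (z ∷ l) ¬m = (¬m ∘ here ∘ inj₁ , ¬m ∘ here ∘ inj₂) ∷ far l (¬m ∘ there)

  PathAdj : ∀ {k} → Fin k → Fin k → Set
  PathAdj i j = suc (toℕ i) ≡ toℕ j ⊎ suc (toℕ j) ≡ toℕ i

  module _ {y : V} where

    IPath-injective : ∀ {x l} → IPath y x l → ∀ i j → lookup (x ∷ l) i ≡ lookup (x ∷ l) j → i ≡ j
    IPath-injective p zero zero eq = refl
    IPath-injective (step e f p) zero (suc zero) eq = contradiction eq (E⇒≢ e)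
    IPath-injective (step {l = l} e f p) zero (suc (suc j)) eq =
      contradiction eq (proj₁ (All.lookup f (∈-lookup j)))
    IPath-injective (step e f p) (suc zero) zero eq = contradiction (≡-sym eq) (E⇒≢ e)
    IPath-injective (step e f p) (suc (suc j)) zero eq =
      contradiction (≡-sym eq) (proj₁ (All.lookup f (∈-lookup j)))
    IPath-injective (step e f p) (suc i) (suc j) eq = cong suc (IPath-injective p i j eq)

    IPath-adj⁺ : ∀ {x l} → IPath y x l → ∀ i j → E (lookup (x ∷ l) i) (lookup (x ∷ l) j) → PathAdj i j
    IPath-adj⁺ p zero zero d = contradiction d E-irrefl
    IPath-adj⁺ (step e f p) zero (suc zero) d = inj₁ refl
    IPath-adj⁺ (step e f p) zero (suc (suc j)) d = contradiction d (proj₂ (All.lookup f (∈-lookup j)))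
    IPath-adj⁺ (step e f p) (suc zero) zero d = inj₂ refl
    IPath-adj⁺ (step e f p) (suc (suc j)) zero d =
      contradiction (E-sym d) (proj₂ (All.lookup f (∈-lookup j)))
    IPath-adj⁺ (step e f p) (suc i) (suc j) d with IPath-adj⁺ p i j d
    ... | inj₁ eq = inj₁ (cong suc eq)
    ... | inj₂ eq = inj₂ (cong suc eq)

    IPath-succ : ∀ {x l} → IPath y x l → ∀ i j → suc (toℕ i) ≡ toℕ j →
                 E (lookup (x ∷ l) i) (lookup (x ∷ l) j)
    IPath-succ (step e f p) zero (suc zero) eq = e
    IPath-succ (step e f p) zero (suc (suc j)) ()
    IPath-succ (step e f p) (suc i) (suc j) eq = IPath-succ p i j (ℕ.suc-injective eq)

    IPath-adj⁻ : ∀ {x l} → IPath y x l → ∀ i j → PathAdj i j → E (lookup (x ∷ l) i) (lookup (x ∷ l) j)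
    IPath-adj⁻ p i j = [ IPath-succ p i j , E-sym ∘ IPath-succ p j i ]′

    IPath-last⁺ : ∀ {x l} → IPath y x l → ∀ i → toℕ i ≡ length l → lookup (x ∷ l) i ≡ y
    IPath-last⁺ end zero eq = refl
    IPath-last⁺ (step e f p) (suc i) eq = IPath-last⁺ p i (ℕ.suc-injective eq)

    IPath-last⁻ : ∀ {x l} → IPath y x l → ∀ i → lookup (x ∷ l) i ≡ y → toℕ i ≡ length l
    IPath-last⁻ {l = l} p i eq =
      trans (cong toℕ (IPath-injective p i (fromℕ _) (trans eq (≡-sym (IPath-last⁺ p (fromℕ _) (toℕ-fromℕ _))))))
            (toℕ-fromℕ (length l))

  -- An induced path closed up by a vertex v adjacent exactly to its ends is an induced cycle.
  chordal⇒no-bypass : Chordal G → ∀ {v x y l} → E v x → E v y → x ≢ y → ¬ E x y → IPath y x l →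
                      All (λ z → z ≡ x ⊎ z ≡ y ⊎ (z ≢ v × ¬ E v z)) (x ∷ l) → ⊥
  chordal⇒no-bypass ch {v} {x} {y} {l} vx vy x≢y ¬xy p q =
    ch (suc (suc (length l))) (long p) (lookup (v ∷ x ∷ l) , inj _ _ , λ i j → mk⇔ (to i j) (from i j))
    where
    -- `x≢y` and `¬xy` exclude paths on one or two vertices, so the cycle through `v` has at least
    -- four.
    long : ∀ {l} → IPath y x l → 4 ≤ suc (suc (length l))
    long end                   = contradiction refl x≢y
    long (step e _ end)        = contradiction e ¬xy
    long (step _ _ (step _ _ _)) = s≤s (s≤s (s≤s (s≤s z≤n)))

    v∉ : ∀ i → v ≢ lookup (x ∷ l) i
    v∉ i eq with All.lookup q (∈-lookup {xs = x ∷ l} i)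
    ... | inj₁ z≡x = E⇒≢ vx (trans eq z≡x)
    ... | inj₂ (inj₁ z≡y) = E⇒≢ vy (trans eq z≡y)
    ... | inj₂ (inj₂ (z≢v , _)) = z≢v (≡-sym eq)

    inj : ∀ i j → lookup (v ∷ x ∷ l) i ≡ lookup (v ∷ x ∷ l) j → i ≡ j
    inj zero    zero    eq = refl
    inj zero    (suc j) eq = contradiction eq (v∉ j)
    inj (suc i) zero    eq = contradiction (≡-sym eq) (v∉ i)
    inj (suc i) (suc j) eq = cong suc (IPath-injective p i j eq)

    v-adj⁺ : ∀ i → E v (lookup (x ∷ l) i) → toℕ i ≡ 0 ⊎ toℕ i ≡ length l
    v-adj⁺ i e with All.lookup q (∈-lookup {xs = x ∷ l} i)
    ... | inj₁ z≡x = inj₁ (cong toℕ (IPath-injective p i zero z≡x))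
    ... | inj₂ (inj₁ z≡y) = inj₂ (IPath-last⁻ p i z≡y)
    ... | inj₂ (inj₂ (_ , ¬e)) = contradiction e ¬e

    v-adj⁻ : ∀ i → toℕ i ≡ 0 ⊎ toℕ i ≡ length l → E v (lookup (x ∷ l) i)
    v-adj⁻ zero (inj₁ eq) = vx
    v-adj⁻ i (inj₂ eq) = subst (E v) (≡-sym (IPath-last⁺ p i eq)) vy

    to : ∀ i j → E (lookup (v ∷ x ∷ l) i) (lookup (v ∷ x ∷ l) j) → CycAdj (suc (suc (length l))) i j
    to zero    zero    e = contradiction e E-irrefl
    to zero    (suc j) e with v-adj⁺ j e
    ... | inj₁ eq = inj₁ (cong suc (≡-sym eq))
    ... | inj₂ eq = inj₂ (inj₂ (inj₁ (refl , cong (2 +_) eq)))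
    to (suc i) zero    e with v-adj⁺ i (E-sym e)
    ... | inj₁ eq = inj₂ (inj₁ (cong suc (≡-sym eq)))
    ... | inj₂ eq = inj₂ (inj₂ (inj₂ (refl , cong (2 +_) eq)))
    to (suc i) (suc j) e with IPath-adj⁺ p i j e
    ... | inj₁ eq = inj₁ (cong suc eq)
    ... | inj₂ eq = inj₂ (inj₁ (cong suc eq))

    suc²-injective : ∀ {a b} → suc (suc a) ≡ suc (suc b) → a ≡ b
    suc²-injective refl = refl

    from : ∀ i j → CycAdj (suc (suc (length l))) i j → E (lookup (v ∷ x ∷ l) i) (lookup (v ∷ x ∷ l) j)
    from zero zero (inj₂ (inj₂ (inj₁ (_ , ()))))
    from zero zero (inj₂ (inj₂ (inj₂ (_ , ()))))
    from zero (suc j) (inj₁ eq) = v-adj⁻ j (inj₁ (≡-sym (ℕ.suc-injective eq)))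
    from zero (suc j) (inj₂ (inj₂ (inj₁ (_ , eq)))) = v-adj⁻ j (inj₂ (suc²-injective eq))
    from (suc i) zero (inj₂ (inj₁ eq)) = E-sym (v-adj⁻ i (inj₁ (≡-sym (ℕ.suc-injective eq))))
    from (suc i) zero (inj₂ (inj₂ (inj₂ (_ , eq)))) = E-sym (v-adj⁻ i (inj₂ (suc²-injective eq)))
    from (suc i) (suc j) (inj₁ eq) = IPath-adj⁻ p i j (inj₁ (ℕ.suc-injective eq))
    from (suc i) (suc j) (inj₂ (inj₁ eq)) = IPath-adj⁻ p i j (inj₂ (ℕ.suc-injective eq))
    from (suc i) (suc j) (inj₂ (inj₂ (inj₁ (() , _))))
    from (suc i) (suc j) (inj₂ (inj₂ (inj₂ (() , _))))

  -- Components of induced subgraphs.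

  Within : (V → Set) → V → V → Set
  Within C a b = E a b × C a × C b

  Within-sym : ∀ {C a b} → Within C a b → Within C b a
  Within-sym (e , a , b) = E-sym e , b , a

  record Component (R : Subset (N G)) (r : V) : Set where
    field
      C       : Subset (N G)
      root    : r ∈ C
      C⊆R     : ∀ {a} → a ∈ C → a ∈ R
      connect : ∀ {a} → a ∈ C → Star (Within (_∈ C)) a r
      closed  : ∀ {a b} → a ∈ C → b ∈ R → E a b → b ∈ C

  -- Grows the component by shrinking the set D of those vertices of R not reached yet.
  component : ∀ {R r} → r ∈ R → Component R r
  component {R} {r} r∈R = grow D₀ (⊂-wellFounded D₀) (λ r∈D → proj₂ (∈-comprehension⁻ D₀? r∈D) refl) conn₀
    where
    D₀? : Decidable (λ z → z ∈ R × z ≢ r)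
    D₀? z = z ∈? R ×-dec ¬? (z ≟ r)
    D₀ = ⟪ D₀? ⟫

    Reached : Subset (N G) → V → Set
    Reached D a = a ∈ R × a ∉ D

    conn₀ : ∀ {a} → Reached D₀ a → Star (Within (Reached D₀)) a r
    conn₀ {a} (a∈R , a∉D) with a ≟ r
    ... | yes refl = ε
    ... | no a≢r = contradiction (∈-comprehension⁺ D₀? (a∈R , a≢r)) a∉D

    grow : ∀ D → Acc _⊂_ D → r ∉ D → (∀ {a} → Reached D a → Star (Within (Reached D)) a r) → Component R r
    grow D (acc rs) r∉D conn
      with any? (λ a → (a ∈? R ×-dec ¬? (a ∈? D)) ×-dec any? (λ b → (b ∈? R ×-dec b ∈? D) ×-dec E? a b))
    ... | yes (a , ra , b , (b∈R , b∈D) , ab) =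
      grow (D - b) (rs (x∈p⇒p-x⊂p b∈D)) (r∉D ∘ D-b⊆D) conn′
      where
      D-b⊆D : ∀ {z} → z ∈ D - b → z ∈ D
      D-b⊆D = p─q⊆p D ⁅ b ⁆
      mono : ∀ {z} → Reached D z → Reached (D - b) z
      mono (z∈R , z∉D) = z∈R , z∉D ∘ D-b⊆D
      lift : ∀ {z} → Reached D z → Star (Within (Reached (D - b))) z r
      lift rz = Star.map (λ (e , u , w) → e , mono u , mono w) (conn rz)
      conn′ : ∀ {z} → Reached (D - b) z → Star (Within (Reached (D - b))) z r
      conn′ {z} (z∈R , z∉D′) with z ∈? D
      ... | no z∉D = lift (z∈R , z∉D)
      ... | yes z∈D with z ≟ b
      ... | yes refl = (E-sym ab , (z∈R , z∉D′) , mono ra) ◅ lift ra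
      ... | no z≢b = contradiction (x∈p∧x≢y⇒x∈p-y z∈D z≢b) z∉D′
    ... | no ¬grow = record
      { C       = ⟪ C? ⟫
      ; root    = C⁺ (r∈R , r∉D)
      ; C⊆R     = proj₁ ∘ C⁻
      ; connect = λ a∈C → Star.map (λ (e , u , w) → e , C⁺ u , C⁺ w) (conn (C⁻ a∈C))
      ; closed  = λ {a} {b} a∈C b∈R ab → C⁺ (b∈R , λ b∈D → ¬grow (a , C⁻ a∈C , b , (b∈R , b∈D) , ab))
      }
      where
      C? : Decidable (Reached D)
      C? z = z ∈? R ×-dec ¬? (z ∈? D)
      C⁺ : ∀ {z} → Reached D z → z ∈ ⟪ C? ⟫
      C⁺ = ∈-comprehension⁺ C?
      C⁻ : ∀ {z} → z ∈ ⟪ C? ⟫ → Reached D z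
      C⁻ = ∈-comprehension⁻ C?

  -- Simplicial vertices.

  Simplicial : Subset (N G) → V → Set
  Simplicial U w = w ∈ U × (∀ {a b} → a ∈ U → b ∈ U → E w a → E w b → a ≢ b → E a b)

  module _ (ch : Chordal G) where

    -- If `x` and `y` were not adjacent, the walk from `x` through `C` to `y` could be cut down to
    -- an induced path whose inner vertices are far from `v`. Closed up by `v`, it would be an
    -- induced cycle of length at least four.
    connected-in⇒adjacent : ∀ {C : V → Set} {v x y c d} → E v x → E v y → x ≢ y →
                            (∀ {z} → C z → z ≢ v × ¬ E v z) →
                            E x c → E y d → C d → Star (Within C) c d → E x y
    connected-in⇒adjacent {C} {v} {x} {y} vx vy x≢y C-far xc yd d∈ path = decidable-stable (E? x y) λ ¬xy →
      let l , p , q = along d∈ yd path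
          l′ , p′ , q′ = extend (inj₁ refl) q p (here (inj₂ xc))
      in chordal⇒no-bypass ch vx vy x≢y ¬xy p′ q′
      where
      Q : V → Set
      Q z = z ≡ x ⊎ z ≡ y ⊎ (z ≢ v × ¬ E v z)
      far : ∀ {z} → C z → Q z
      far cz = inj₂ (inj₂ (C-far cz))
      along : ∀ {c d} → C d → E y d → Star (Within C) c d → ∃ λ l → IPath y c l × All Q (c ∷ l)
      along d∈ yd ε = y ∷ [] , step (E-sym yd) [] end , far d∈ ∷ inj₂ (inj₁ refl) ∷ []
      along d∈ yd ((e , a∈ , _) ◅ path) =
        let l , p , q = along d∈ yd path in extend (far a∈) q p (here (inj₂ e))

    module Boundary {U : Subset (N G)} {v x : V} (v∈U : v ∈ U) (x∈U : x ∈ U) (x≢v : x ≢ v) (¬vx : ¬ E v x) where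

      R? : Decidable (λ z → z ∈ U × z ≢ v × ¬ E v z)
      R? z = z ∈? U ×-dec ¬? (z ≟ v) ×-dec ¬? (E? v z)

      open Component (component (∈-comprehension⁺ R? (x∈U , x≢v , ¬vx))) public

      -- The closed neighbourhood of `C` in `U`; its vertices outside `C` separate `C` from `v`.
      W? : Decidable (λ z → z ∈ U × (z ∈ C ⊎ ∃ λ c → c ∈ C × E c z))
      W? z = z ∈? U ×-dec (z ∈? C ⊎-dec any? (λ c → c ∈? C ×-dec E? c z))

      W : Subset (N G)
      W = ⟪ W? ⟫

      C⊆U : ∀ {a} → a ∈ C → a ∈ U
      C⊆U = proj₁ ∘ ∈-comprehension⁻ R? ∘ C⊆R

      C-far : ∀ {a} → a ∈ C → a ≢ v × ¬ E v a
      C-far = proj₂ ∘ ∈-comprehension⁻ R? ∘ C⊆R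

      neighbour∈W : ∀ {c a} → c ∈ C → a ∈ U → E c a → a ∈ W
      neighbour∈W {c} c∈C a∈U ca = ∈-comprehension⁺ W? (a∈U , inj₂ (c , c∈C , ca))

      v∉C : v ∉ C
      v∉C v∈C = proj₁ (C-far v∈C) refl

      v∉W : v ∉ W
      v∉W v∈W with proj₂ (∈-comprehension⁻ W? v∈W)
      ... | inj₁ v∈C            = v∉C v∈C
      ... | inj₂ (c , c∈C , cv) = proj₂ (C-far c∈C) (E-sym cv)

      C⊂U : C ⊂ U
      C⊂U = C⊆U , v , v∈U , v∉C

      W⊂U : W ⊂ U
      W⊂U = proj₁ ∘ ∈-comprehension⁻ W? , v , v∈U , v∉W

      -- If `s` were not adjacent to `v`, it would be among the vertices whose component is `C`, and
      -- `closed` would put it into `C`.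
      boundary-edges : ∀ {s} → s ∈ W → s ∉ C → E v s × ∃ λ c → c ∈ C × E s c
      boundary-edges {s} s∈W s∉C with ∈-comprehension⁻ W? s∈W
      ... | _ , inj₁ s∈C = contradiction s∈C s∉C
      ... | s∈U , inj₂ (c , c∈C , cs) = decidable-stable (E? v s) (λ ¬vs →
        s∉C (closed c∈C (∈-comprehension⁺ R? (s∈U , (λ { refl → v∉W s∈W }) , ¬vs)) cs)) , c , c∈C , E-sym cs

      -- Both vertices are adjacent to `v` and to the connected set `C`, which is far from `v`. This
      -- is the fact that minimal separators of a chordal graph are cliques.
      boundary-clique : ∀ {s t} → s ∈ W → s ∉ C → t ∈ W → t ∉ C → s ≢ t → E s t
      boundary-clique s∈W s∉C t∈W t∉C s≢t
        with boundary-edges s∈W s∉C | boundary-edges t∈W t∉C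
      ... | vs , c , c∈C , sc | vt , d , d∈C , td =
        connected-in⇒adjacent {C = _∈ C} vs vt s≢t C-far sc td d∈C
          (connect c∈C ◅◅ reverse Within-sym (connect d∈C))

    ExistsSimplicial : Subset (N G) → Set
    ExistsSimplicial U = ∀ {v} → v ∈ U → ∃ (Simplicial U)

    -- Dirac's strengthening, which carries the induction: the simplicial vertex can be found away
    -- from any `v` that is not adjacent to all the rest of `U`.
    ExistsFarSimplicial : Subset (N G) → Set
    ExistsFarSimplicial U = ∀ {v x} → v ∈ U → x ∈ U → x ≢ v → ¬ E v x → ∃ λ w → Simplicial U w × w ≢ v × ¬ E v w

    -- The boundary W ∖ C of a component C of the non-neighbours of v is a clique, so a simplicial
    -- vertex of U can be found in C by recursion into W (or into C, if W ∖ C is complete to W).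
    far-simplicial-step : ∀ {U} → (∀ {U′} → U′ ⊂ U → ExistsSimplicial U′) → (∀ {U′} → U′ ⊂ U → ExistsFarSimplicial U′) →
                          ExistsFarSimplicial U
    far-simplicial-step {U} exists far {v} {x} v∈U x∈U x≢v ¬vx = result
      where
      open Boundary v∈U x∈U x≢v ¬vx

      result : ∃ λ w → Simplicial U w × w ≢ v × ¬ E v w
      result with any? (λ s → (s ∈? W ×-dec ¬? (s ∈? C)) ×-dec
                              any? (λ z → (z ∈? W ×-dec ¬? (z ≟ s)) ×-dec ¬? (E? s z)))
      ... | yes (s , (s∈W , s∉C) , z , (z∈W , z≢s) , ¬sz)
        -- `s` takes the role of `v`. As `w` is not adjacent to `s`, it is not in the clique outside
        -- `C`. A vertex of `C` has all its neighbours in `U` within `W`, so being simplicial in `W`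
        -- suffices.
        with w , (w∈W , sw) , w≢s , ¬sw ← far W⊂U s∈W z∈W z≢s ¬sz
        with w ∈? C
      ... | no w∉C = contradiction (boundary-clique s∈W s∉C w∈W w∉C (w≢s ∘ ≡-sym)) ¬sw
      ... | yes w∈C = w , (C⊆U w∈C , λ a∈U b∈U wa wb →
        sw (neighbour∈W w∈C a∈U wa) (neighbour∈W w∈C b∈U wb) wa wb) , C-far w∈C
      -- The neighbours of `w` inside `C` form a clique, and those outside `C` are adjacent to
      -- everything else in `W`.
      result | no complete with w , w∈C , sw ← exists C⊂U root =
        w , (C⊆U w∈C , λ {a} {b} a∈U b∈U wa wb → clique (neighbour∈W w∈C a∈U wa) (neighbour∈W w∈C b∈U wb) wa wb)
          , C-far w∈C
        where
        complete-to-W : ∀ {s z} → s ∈ W → s ∉ C → z ∈ W → z ≢ s → E s z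
        complete-to-W {s} {z} s∈W s∉C z∈W z≢s =
          decidable-stable (E? s z) λ ¬sz → complete (s , (s∈W , s∉C) , z , (z∈W , z≢s) , ¬sz)
        clique : ∀ {a b} → a ∈ W → b ∈ W → E w a → E w b → a ≢ b → E a b
        clique {a} {b} a∈W b∈W wa wb a≢b with a ∈? C | b ∈? C
        ... | no a∉C  | _       = complete-to-W a∈W a∉C b∈W (a≢b ∘ ≡-sym)
        ... | yes _   | no b∉C  = E-sym (complete-to-W b∈W b∉C a∈W a≢b)
        ... | yes a∈C | yes b∈C = sw a∈C b∈C wa wb a≢b

    -- If `v` is adjacent to all the rest of `U`, putting `v` back enlarges the neighbourhood of a
    -- simplicial vertex of `U - v` to a larger clique.
    simplicial-step : ∀ {U} → (∀ {U′} → U′ ⊂ U → ExistsSimplicial U′) → ExistsFarSimplicial U → ExistsSimplicial U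
    simplicial-step {U} exists far {v} v∈U with any? (λ x → (x ∈? U ×-dec ¬? (x ≟ v)) ×-dec ¬? (E? v x))
    ... | yes (x , (x∈U , x≢v) , ¬vx) = let w , s , _ = far v∈U x∈U x≢v ¬vx in w , s
    ... | no universal with any? (λ x → x ∈? U ×-dec ¬? (x ≟ v))
    ... | no alone = v , v∈U , λ {a} a∈U _ va _ _ → contradiction (a , a∈U , (E⇒≢ va ∘ ≡-sym)) alone
    ... | yes (x , x∈U , x≢v) =
      let w , w∈U′ , sw = exists (x∈p⇒p-x⊂p v∈U) (x∈p∧x≢y⇒x∈p-y x∈U x≢v)
      in w , p─q⊆p U ⁅ v ⁆ w∈U′ , λ {a} {b} → clique sw {a} {b}
      where
      v-adj : ∀ {z} → z ∈ U → z ≢ v → E v z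
      v-adj {z} z∈U z≢v = decidable-stable (E? v z) λ ¬vz → universal (z , (z∈U , z≢v) , ¬vz)
      clique : ∀ {w} → (∀ {a b} → a ∈ U - v → b ∈ U - v → E w a → E w b → a ≢ b → E a b) →
               ∀ {a b} → a ∈ U → b ∈ U → E w a → E w b → a ≢ b → E a b
      clique sw {a} {b} a∈ b∈ wa wb a≢b with a ≟ v | b ≟ v
      ... | yes refl | _        = v-adj b∈ (a≢b ∘ ≡-sym)
      ... | no a≢v   | yes refl = E-sym (v-adj a∈ a≢b)
      ... | no a≢v   | no b≢v   = sw (x∈p∧x≢y⇒x∈p-y a∈ a≢v) (x∈p∧x≢y⇒x∈p-y b∈ b≢v) wa wb a≢b

    simplicial-exists : ∀ U → ExistsSimplicial U
    simplicial-exists U = proj₁ (go (⊂-wellFounded U))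
      where
      go : ∀ {U} → Acc _⊂_ U → ExistsSimplicial U × ExistsFarSimplicial U
      go {U} (acc rs) = (λ {v} → simplicial-step exists far {v}) , (λ {v} {x} → far {v} {x})
        where
        exists : ∀ {U′} → U′ ⊂ U → ExistsSimplicial U′
        exists U′⊂U = proj₁ (go (rs U′⊂U))
        far : ExistsFarSimplicial U
        far = far-simplicial-step exists (λ U′⊂U {v} {x} → proj₂ (go (rs U′⊂U)) {v} {x})

  -- Perfect elimination orderings.

  -- A perfect elimination ordering of U, listed by increasing rank r.
  record Ranking (U : Subset (N G)) : Set where
    field
      r       : V → ℕ
      bound   : ℕ
      r<bound : ∀ {x} → x ∈ U → r x < bound
      r-inj   : ∀ {x y} → x ∈ U → y ∈ U → r x ≡ r y → x ≡ y
      clique  : ∀ {x a b} → x ∈ U → a ∈ U → b ∈ U → E x a → E x b → r a < r x → r b < r x → a ≢ b → E a b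

  chordal⇒ranking : Chordal G → ∀ U → Ranking U
  chordal⇒ranking ch U = go U (⊂-wellFounded U)
    where
    go : ∀ U → Acc _⊂_ U → Ranking U
    go U (acc rs) with any? (_∈? U)
    ... | no empty = record
      { r = λ _ → 0 ; bound = 0
      ; r<bound = λ x∈ → contradiction (_ , x∈) empty
      ; r-inj = λ x∈ → contradiction (_ , x∈) empty
      ; clique = λ x∈ → contradiction (_ , x∈) empty }
    ... | yes (v , v∈U) with w , w∈U , sw ← simplicial-exists ch U v∈U = record
      { r = r′ ; bound = suc bound ; r<bound = bound′ ; r-inj = inj′ ; clique = clique′ }
      where
      U⁺ : ∀ {z} → z ∈ U → z ≢ w → z ∈ U - w
      U⁺ = x∈p∧x≢y⇒x∈p-y
      open Ranking (go (U - w) (rs (x∈p⇒p-x⊂p w∈U)))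

      -- The simplicial vertex `w` comes last: its earlier neighbours form a clique by `sw`, and it
      -- is an earlier neighbour of no other vertex.
      r′ : V → ℕ
      r′ z with z ≟ w
      ... | yes _ = bound
      ... | no _  = r z

      bound′ : ∀ {x} → x ∈ U → r′ x < suc bound
      bound′ {x} x∈U with x ≟ w
      ... | yes _  = n<1+n bound
      ... | no x≢w = m<n⇒m<1+n (r<bound (U⁺ x∈U x≢w))

      inj′ : ∀ {x y} → x ∈ U → y ∈ U → r′ x ≡ r′ y → x ≡ y
      inj′ {x} {y} x∈U y∈U eq with x ≟ w | y ≟ w
      ... | yes refl | yes refl = refl
      ... | yes refl | no y≢w   = contradiction (r<bound (U⁺ y∈U y≢w)) (<-irrefl (≡-sym eq))
      ... | no x≢w   | yes refl = contradiction (r<bound (U⁺ x∈U x≢w)) (<-irrefl eq)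
      ... | no x≢w   | no y≢w   = r-inj (U⁺ x∈U x≢w) (U⁺ y∈U y≢w) eq

      clique′ : ∀ {x a b} → x ∈ U → a ∈ U → b ∈ U → E x a → E x b → r′ a < r′ x → r′ b < r′ x → a ≢ b → E a b
      clique′ {x} {a} {b} x∈U a∈U b∈U xa xb a<x b<x a≢b with x ≟ w | a ≟ w | b ≟ w
      ... | yes refl | _        | _        = sw a∈U b∈U xa xb a≢b
      ... | no x≢w   | yes refl | _        = contradiction (r<bound (U⁺ x∈U x≢w)) (<-asym a<x)
      ... | no x≢w   | no _     | yes refl = contradiction (r<bound (U⁺ x∈U x≢w)) (<-asym b<x)
      ... | no x≢w   | no a≢w   | no b≢w   =
        clique (U⁺ x∈U x≢w) (U⁺ a∈U a≢w) (U⁺ b∈U b≢w) xa xb a<x b<x a≢b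

-- The colouring game

module _ (G : Graph) (s : Coloring G 4) (v : V G) (c : Fin 4) where

  update-nothing : ∀ {w} → update {G} s v c w ≡ nothing → w ≢ v × s w ≡ nothing
  update-nothing {w} eq with w ≟ v
  ... | no w≢v = w≢v , eq

  update-just : ∀ {w d} → update {G} s v c w ≡ just d → (w ≡ v × c ≡ d) ⊎ s w ≡ just d
  update-just {w} eq with w ≟ v
  ... | yes w≡v = inj₁ (w≡v , just-injective eq)
  ... | no _    = inj₂ eq

  update-self : update {G} s v c v ≡ just c
  update-self with v ≟ v
  ... | yes _  = refl
  ... | no v≢v = contradiction refl v≢v

module Strategy
  (G : Graph) (r : V G → ℕ)
  (r-inj : ∀ {x y} → r x ≡ r y → x ≡ y)
  (clique : ∀ {x a b} → E G x a → E G x b → r a < r x → r b < r x → a ≢ b → E G a b)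
  (no-K₄ : ¬ HasClique G 4)
  where

  -- Parents in the elimination ordering.

  Parent : V G → V G → Set
  Parent x y = E G x y × r y < r x

  Parent? : ∀ x y → Dec (Parent x y)
  Parent? x y = E? G x y ×-dec (r y <? r x)

  K₄-free : ∀ {a b c d} → E G a b → E G a c → E G a d → E G b c → E G b d → E G c d → ⊥
  K₄-free {a} {b} {c} {d} ab ac ad bc bd cd = no-K₄ (f , inj , edge)
    where
    f : Fin 4 → V G
    f = Vec.lookup (a ∷ b ∷ c ∷ d ∷ [])
    edge : ∀ i j → ¬ i ≡ j → E G (f i) (f j)
    edge zero zero i≢j = contradiction refl i≢j
    edge zero (suc zero) _ = ab
    edge zero (suc (suc zero)) _ = ac
    edge zero (suc (suc (suc zero))) _ = ad
    edge (suc zero) zero _ = E-sym G ab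
    edge (suc zero) (suc zero) i≢j = contradiction refl i≢j
    edge (suc zero) (suc (suc zero)) _ = bc
    edge (suc zero) (suc (suc (suc zero))) _ = bd
    edge (suc (suc zero)) zero _ = E-sym G ac
    edge (suc (suc zero)) (suc zero) _ = E-sym G bc
    edge (suc (suc zero)) (suc (suc zero)) i≢j = contradiction refl i≢j
    edge (suc (suc zero)) (suc (suc (suc zero))) _ = cd
    edge (suc (suc (suc zero))) zero _ = E-sym G ad
    edge (suc (suc (suc zero))) (suc zero) _ = E-sym G bd
    edge (suc (suc (suc zero))) (suc (suc zero)) _ = E-sym G cd
    edge (suc (suc (suc zero))) (suc (suc (suc zero))) i≢j = contradiction refl i≢j
    inj : ∀ {i j} → f i ≡ f j → i ≡ j
    inj {i} {j} eq = decidable-stable (i ≟ j) λ i≢j → E⇒≢ G (edge i j i≢j) eq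

  -- Parents of `u` are pairwise adjacent, so three of them would form a K₄ with `u`. If there are
  -- fewer than two, `p` is padded with `u` or with a repetition, as it only has to cover the
  -- parents.
  parents : ∀ u → ∃ λ (p : Fin 2 → V G) → ∀ {x} → Parent u x → ∃ λ i → x ≡ p i
  parents u with any? (Parent? u)
  ... | no none = (λ _ → u) , λ par → contradiction (_ , par) none
  ... | yes (a , ua , a<u) with any? (λ b → Parent? u b ×-dec ¬? (b ≟ a))
  ... | no none = (λ _ → a) , λ {x} par → zero , decidable-stable (x ≟ a) λ x≢a → none (x , par , x≢a)
  ... | yes (b , (ub , b<u) , b≢a) = Vec.lookup (a ∷ b ∷ []) , index
    where
    index : ∀ {x} → Parent u x → ∃ λ i → x ≡ Vec.lookup (a ∷ b ∷ []) i
    index {x} (ux , x<u) with x ≟ a | x ≟ b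
    ... | yes x≡a | _       = zero , x≡a
    ... | no _    | yes x≡b = suc zero , x≡b
    ... | no x≢a  | no x≢b  = ⊥-elim (K₄-free ua ub ux (clique ua ub a<u b<u (b≢a ∘ ≡-sym))
      (clique ua ux a<u x<u (x≢a ∘ ≡-sym)) (clique ub ux b<u x<u (x≢b ∘ ≡-sym)))

  least : ∀ {P : V G → Set} → Decidable P → ∃ P → ∃ λ y → P y × (∀ {u} → P u → r y ≤ r u)
  least {P} P? (y , py) = go py (<-wellFounded (r y))
    where
    go : ∀ {y} → P y → Acc _<_ (r y) → ∃ λ y → P y × (∀ {u} → P u → r y ≤ r u)
    go {y} py (acc rs) with any? (λ u → P? u ×-dec (r u <? r y))
    ... | yes (u , pu , u<y) = go pu (rs u<y)
    ... | no none = y , py , λ pu → ≮⇒≥ λ u<y → none (_ , pu , u<y)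

  -- Activation and its invariant.

  State : Set
  State = Coloring G 4

  Uncoloured : State → V G → Set
  Uncoloured s v = s v ≡ nothing

  Uncoloured? : ∀ s v → Dec (Uncoloured s v)
  Uncoloured? s v = ≡-dec _≟_ (s v) nothing

  UncolouredParent : State → V G → V G → Set
  UncolouredParent s x u = Parent x u × Uncoloured s u

  uncolouredParent? : ∀ s x → Decidable (UncolouredParent s x)
  uncolouredParent? s x u = Parent? x u ×-dec Uncoloured? s u

  -- An activated vertex x remembers the vertex y it sent Alice to, and whether y was already active
  -- then (in which case Alice coloured y).
  Slots : Set
  Slots = V G → Maybe (V G × Bool)

  Active : Slots → V G → Set
  Active st x = ∃ λ k → st x ≡ just k

  active? : ∀ st x → Active st x ⊎ st x ≡ nothing
  active? st x with st x
  ... | just k  = inj₁ (k , refl)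
  ... | nothing = inj₂ refl

  _[_↦_] : Slots → V G → V G × Bool → Slots
  (st [ x ↦ k ]) z with z ≟ x
  ... | yes _ = just k
  ... | no _  = st z

  module _ (st : Slots) (x : V G) (k : V G × Bool) where

    assign-self : Active (st [ x ↦ k ]) x
    assign-self with x ≟ x
    ... | yes _  = k , refl
    ... | no x≢x = contradiction refl x≢x

    assign-mono : ∀ {z} → Active st z → Active (st [ x ↦ k ]) z
    assign-mono {z} a with z ≟ x
    ... | yes _ = k , refl
    ... | no _  = a

    assign-just : ∀ {z k′} → (st [ x ↦ k ]) z ≡ just k′ → (z ≡ x × k ≡ k′) ⊎ st z ≡ just k′
    assign-just {z} eq with z ≟ x
    ... | yes z≡x = inj₁ (z≡x , just-injective eq)
    ... | no _    = inj₂ eq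

  -- Pending holds for the vertex whose activation is due (at most one): the vertex just coloured by
  -- Bob, or the vertex that Alice's walk has just reached.
  record Inv (s : State) (st : Slots) (Pending : V G → Set) : Set where
    field
      target-parent : ∀ {x y b} → st x ≡ just (y , b) → Parent x y
      -- Colouring shrinks the set of uncoloured parents, so minimality persists, even after the
      -- target itself is coloured.
      target-least  : ∀ {x y b u} → st x ≡ just (y , b) → Parent x u → Uncoloured s u → r y ≤ r u
      -- Each vertex is a target at most once per bit, hence at most twice.
      slot-inj      : ∀ {x x′ k} → st x ≡ just k → st x′ ≡ just k → x ≡ x′
      -- The first visit, with bit `false`, activates the target; a second one would have coloured
      -- it.
      target-fresh  : ∀ {x u b} → st x ≡ just (u , b) → Uncoloured s u → Pending u ⊎ (b ≡ false × Active st u)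
      -- Guarantees that every coloured child of an uncoloured vertex, unless pending, has a target
      -- to be charged to.
      active        : ∀ {x c u} → s x ≡ just c → Parent x u → Uncoloured s u → Pending x ⊎ Active st x

  open Inv

  None : V G → Set
  None _ = ⊥

  inv-start : Inv (emptyColoring G 4) (λ _ → nothing) None
  inv-start = record
    { target-parent = λ () ; target-least = λ () ; slot-inj = λ () ; target-fresh = λ () ; active = λ () }

  weaken : ∀ {s st y} → Inv s st None → Inv s st (_≡ y)
  weaken i = record
    { target-parent = target-parent i
    ; target-least  = target-least i
    ; slot-inj      = slot-inj i
    ; target-fresh  = λ e u → [ (λ ()) , inj₂ ]′ (target-fresh i e u)
    ; active        = λ e p u → [ (λ ()) , inj₂ ]′ (active i e p u)
    }

  -- When activation is no longer due: without uncoloured parents, `active` asks nothing of `y`.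
  Settled : State → Slots → V G → Set
  Settled s st y = Active st y ⊎ ¬ ∃ (UncolouredParent s y)

  -- Being coloured makes `target-fresh` vacuous for `b`, and being settled gives `active`.
  settle : ∀ {s st b c} → Inv s st (_≡ b) → s b ≡ just c → Settled s st b → Inv s st None
  settle {s} {st} {b} i sb ok = record
    { target-parent = target-parent i
    ; target-least  = target-least i
    ; slot-inj      = slot-inj i
    ; target-fresh  = fresh
    ; active        = act ok
    }
    where
    fresh : ∀ {x u b} → st x ≡ just (u , b) → Uncoloured s u → ⊥ ⊎ (b ≡ false × Active st u)
    fresh e u with target-fresh i e u
    ... | inj₁ refl with () ← trans (≡-sym sb) u
    ... | inj₂ q = inj₂ q
    act : Settled s st b → ∀ {x c u} → s x ≡ just c → Parent x u → Uncoloured s u → ⊥ ⊎ Active st x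
    act ok e p u with active i e p u
    act _            e p u | inj₂ a    = inj₂ a
    act (inj₁ a)     e p u | inj₁ refl = inj₂ a
    act (inj₂ none)  e p u | inj₁ refl = contradiction (_ , p , u) none

  colour : ∀ {s st y} → Inv s st (_≡ y) → ∀ c → Inv (update {G} s y c) st (_≡ y)
  colour {s} {st} {y} i c = record
    { target-parent = target-parent i
    ; target-least  = λ e p u → target-least i e p (unc u)
    ; slot-inj      = slot-inj i
    ; target-fresh  = λ e u → target-fresh i e (unc u)
    ; active        = act
    }
    where
    unc : ∀ {u} → Uncoloured (update {G} s y c) u → Uncoloured s u
    unc u = proj₂ (update-nothing G s y c u)
    act : ∀ {x d u} → update {G} s y c x ≡ just d → Parent x u → Uncoloured (update {G} s y c) u → x ≡ y ⊎ Active st x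
    act e p u with update-just G s y c e
    ... | inj₁ (x≡y , _) = inj₁ x≡y
    ... | inj₂ e′        = active i e′ p (unc u)

  -- Alice's moves.

  alice-move : ∀ {s st y} → Inv s st (_≡ y) → Settled s st y → ∀ c → Inv (update {G} s y c) st None
  alice-move {s} {st} {y} i ok c = settle (colour i c) (update-self G s y c) ok′
    where
    ok′ : Settled (update {G} s y c) st y
    ok′ = [ inj₁ , (λ none → inj₂ λ (v , p , u) → none (v , p , proj₂ (update-nothing G s y c u))) ]′ ok

  -- The strategy fixes only the vertex. The invariant survives every colour, so any legal one may
  -- be chosen later.
  Reply : State → Set
  Reply s = ∃₂ λ y st → Uncoloured s y × (∀ c → Inv (update {G} s y c) st None)

  OnlyFirst : Slots → V G → Set
  OnlyFirst st x = ∀ {w b} → st w ≡ just (x , b) → b ≡ false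

  -- The pending role passes from `x` to `y`. An uncoloured `x` must then satisfy `target-fresh` on
  -- its own, which `OnlyFirst` and its new slot provide.
  activate : ∀ {s st x y} b → Inv s st (_≡ x) → (Uncoloured s x → OnlyFirst st x) →
             Parent x y → Uncoloured s y → (∀ {u} → UncolouredParent s x u → r y ≤ r u) →
             (Active st y → b ≡ true) → Inv s (st [ x ↦ (y , b) ]) (_≡ y)
  activate {s} {st} {x} {y} b i first par sy y-least bit = record
    { target-parent = λ {z} e → par′ (assign {z} e)
    ; target-least  = λ {z} e → least′ (assign {z} e)
    ; slot-inj      = λ {z} {z′} e e′ → inj′ (assign {z} e) (assign {z′} e′)
    ; target-fresh  = λ {z} e → fresh′ (assign {z} e)
    ; active        = act′
    }
    where
    k = (y , b)
    assign : ∀ {z k′} → (st [ x ↦ k ]) z ≡ just k′ → (z ≡ x × k ≡ k′) ⊎ st z ≡ just k′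
    assign = assign-just st x k
    -- An earlier use of this slot would mean that `b` is `false` and `y` is active, but then `bit`
    -- forces `true`.
    unused : ∀ {z} → st z ≡ just k → ⊥
    unused e with target-fresh i e sy
    ... | inj₁ refl = E-irrefl G (proj₁ par)
    ... | inj₂ (refl , a) with () ← bit a
    par′ : ∀ {z w d} → (z ≡ x × k ≡ (w , d)) ⊎ st z ≡ just (w , d) → Parent z w
    par′ (inj₁ (refl , refl)) = par
    par′ (inj₂ e) = target-parent i e
    least′ : ∀ {z w d u} → (z ≡ x × k ≡ (w , d)) ⊎ st z ≡ just (w , d) → Parent z u → Uncoloured s u → r w ≤ r u
    least′ (inj₁ (refl , refl)) p su = y-least (p , su)
    least′ (inj₂ e) = target-least i e
    inj′ : ∀ {z z′ k′} → (z ≡ x × k ≡ k′) ⊎ st z ≡ just k′ → (z′ ≡ x × k ≡ k′) ⊎ st z′ ≡ just k′ → z ≡ z′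
    inj′ (inj₁ (refl , _)) (inj₁ (refl , _)) = refl
    inj′ (inj₁ (_ , refl)) (inj₂ e)          = ⊥-elim (unused e)
    inj′ (inj₂ e)          (inj₁ (_ , refl)) = ⊥-elim (unused e)
    inj′ (inj₂ e)          (inj₂ e′)         = slot-inj i e e′
    fresh′ : ∀ {z u d} → (z ≡ x × k ≡ (u , d)) ⊎ st z ≡ just (u , d) → Uncoloured s u →
             u ≡ y ⊎ (d ≡ false × Active (st [ x ↦ k ]) u)
    fresh′ (inj₁ (_ , refl)) su = inj₁ refl
    fresh′ (inj₂ e) su with target-fresh i e su
    ... | inj₁ refl    = inj₂ (first su e , assign-self st x k)
    ... | inj₂ (f , a) = inj₂ (f , assign-mono st x k a)
    act′ : ∀ {z c u} → s z ≡ just c → Parent z u → Uncoloured s u → z ≡ y ⊎ Active (st [ x ↦ k ]) z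
    act′ e p su with active i e p su
    ... | inj₁ refl = inj₂ (assign-self st x k)
    ... | inj₂ a    = inj₂ (assign-mono st x k a)

  -- Ranks decrease along the walk, so it ends, either at an active vertex (second visit) or at one
  -- without uncoloured parents. Both are settled and can be coloured.
  walk : ∀ {s st x} → Acc _<_ (r x) → Inv s st (_≡ x) → (Uncoloured s x → OnlyFirst st x) →
         ∃ (UncolouredParent s x) → Reply s
  walk {s} {st} {x} (acc rs) i first par
    with y , (xy , sy) , y-least ← least (uncolouredParent? s x) par
    with active? st y
  ... | inj₁ a = y , st [ x ↦ (y , true) ] , sy ,
    alice-move (activate true i first xy sy y-least (λ _ → refl)) (inj₁ (assign-mono st x (y , true) a))
  ... | inj₂ inactive = continue (any? (uncolouredParent? s y))
    where
    i′ : Inv s (st [ x ↦ (y , false) ]) (_≡ y)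
    i′ = activate false i first xy sy y-least λ (_ , e) → contradiction (trans (≡-sym inactive) e) λ ()
    first′ : OnlyFirst (st [ x ↦ (y , false) ]) y
    first′ {w} e with assign-just st x (y , false) {w} e
    ... | inj₁ (_ , refl) = refl
    ... | inj₂ e′ with target-fresh i e′ sy
    ... | inj₁ refl    = contradiction (proj₁ xy) (E-irrefl G)
    ... | inj₂ (f , _) = f
    continue : Dec (∃ (UncolouredParent s y)) → Reply s
    continue (no none)  = y , st [ x ↦ (y , false) ] , sy , alice-move i′ (inj₂ none)
    continue (yes par′) = walk (rs (proj₂ xy)) i′ (λ _ {w} → first′ {w}) par′

  -- An uncoloured vertex of least rank has no uncoloured parents, so it is settled at once.
  greedy : ∀ {s st} → Inv s st None → Complete G 4 s ⊎ Reply s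
  greedy {s} {st} i with any? (Uncoloured? s)
  ... | no none = inj₁ λ v sv → none (v , sv)
  ... | yes unc with y , sy , y-least ← least (Uncoloured? s) unc =
    inj₂ (y , st , sy , alice-move (weaken i) (inj₂ λ (_ , (_ , u<y) , su) → <⇒≱ u<y (y-least su)))

  respond : ∀ {s st b c} → Inv s st (_≡ b) → s b ≡ just c → Complete G 4 s ⊎ Reply s
  respond {s} {st} {b} i sb with active? st b
  ... | inj₁ a = greedy (settle i sb (inj₁ a))
  ... | inj₂ _ with any? (uncolouredParent? s b)
  ... | no none = greedy (settle i sb (inj₂ none))
  -- `b` is coloured, so the `OnlyFirst` premise of `walk` is vacuous.
  ... | yes par = inj₂ (walk (<-wellFounded (r b)) i (λ u → contradiction (trans (≡-sym sb) u) λ ()) par)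

  -- Counting the coloured neighbours of an uncoloured vertex.

  data Code : Set where
    pending : Code
    parent  : Fin 2 → Code
    slot    : Fin 2 → Bool → Code

  -- One pending vertex, two parents, and two bits for each of two targets: 1 + 2 + 2 · 2 = 7.
  encode : Code → Fin 7
  encode pending                 = zero
  encode (parent zero)           = suc zero
  encode (parent (suc zero))     = suc (suc zero)
  encode (slot zero false)       = suc (suc (suc zero))
  encode (slot zero true)        = suc (suc (suc (suc zero)))
  encode (slot (suc zero) false) = suc (suc (suc (suc (suc zero))))
  encode (slot (suc zero) true)  = suc (suc (suc (suc (suc (suc zero)))))

  decode : Fin 7 → Code
  decode = Vec.lookup (pending ∷ parent zero ∷ parent (suc zero) ∷ slot zero false ∷ slot zero true
                   ∷ slot (suc zero) false ∷ slot (suc zero) true ∷ [])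

  decode-encode : ∀ k → decode (encode k) ≡ k
  decode-encode pending                 = refl
  decode-encode (parent zero)           = refl
  decode-encode (parent (suc zero))     = refl
  decode-encode (slot zero false)       = refl
  decode-encode (slot zero true)        = refl
  decode-encode (slot (suc zero) false) = refl
  decode-encode (slot (suc zero) true)  = refl

  encode-injective : ∀ {k k′} → encode k ≡ encode k′ → k ≡ k′
  encode-injective {k} {k′} eq = trans (≡-sym (decode-encode k)) (trans (cong decode eq) (decode-encode k′))

  Unique : (V G → Set) → Set
  Unique P = ∀ {x y} → P x → P y → x ≡ y

  module _ {s st Pending} (i : Inv s st Pending) (pending-unique : Unique Pending)
           {u} (su : Uncoloured s u) (¬pu : ¬ Pending u) where

    p : Fin 2 → V G
    p = proj₁ (parents u)

    -- A child of u that was sent to u itself is charged to the slot which u took when it was activated.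
    data Coded (x : V G) : Code → Set where
      by-pending : Pending x → Coded x pending
      by-parent  : ∀ {j} → x ≡ p j → Coded x (parent j)
      by-slot    : ∀ {j d} → st x ≡ just (p j , d) → Coded x (slot j d)
      by-self    : ∀ {j d} → st x ≡ just (u , false) → st u ≡ just (p j , d) → Coded x (slot j d)

    -- A slot charged through `by-self` is held by `u`, so by `slot-inj` no vertex other than `u`
    -- can claim it through `by-slot`.
    coded-unique : ∀ {x x′ k} → x ≢ u → x′ ≢ u → Coded x k → Coded x′ k → x ≡ x′
    coded-unique x≢u x′≢u (by-pending q) (by-pending q′) = pending-unique q q′
    coded-unique x≢u x′≢u (by-parent refl) (by-parent refl) = refl
    coded-unique x≢u x′≢u (by-slot e) (by-slot e′) = slot-inj i e e′
    coded-unique x≢u x′≢u (by-slot e) (by-self _ e′) = contradiction (slot-inj i e e′) x≢u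
    coded-unique x≢u x′≢u (by-self _ e) (by-slot e′) = contradiction (slot-inj i e′ e) x′≢u
    coded-unique x≢u x′≢u (by-self e _) (by-self e′ _) = slot-inj i e e′

    coded : ∀ {x c} → E G u x → s x ≡ just c → ∃ (Coded x)
    coded {x} ux sx with <-cmp (r x) (r u)
    ... | tri< x<u _ _ = let j , eq = proj₂ (parents u) (ux , x<u) in _ , by-parent {j = j} eq
    ... | tri≈ _ eq _ = contradiction (≡-sym (r-inj eq)) (E⇒≢ G ux)
    ... | tri> _ _ u<x with active i sx (E-sym G ux , u<x) su
    ... | inj₁ q = _ , by-pending q
    ... | inj₂ ((y , d) , e) with y ≟ u
    -- `y` and `u` are both parents of `x`, hence adjacent, and minimality of `y` makes it a parent
    -- of `u`.
    ... | no y≢u =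
      let xy , y<x = target-parent i e
          y≤u = target-least i e (E-sym G ux , u<x) su
          j , eq = proj₂ (parents u) (clique (E-sym G ux) xy u<x y<x (y≢u ∘ ≡-sym) , ≤∧≢⇒< y≤u (y≢u ∘ r-inj))
      in _ , by-slot {j = j} (trans e (cong (λ z → just (z , d)) eq))
    -- `u` was the target and is still uncoloured and not pending, so it is active and holds a slot
    -- of its own.
    ... | yes refl with target-fresh i e su
    ... | inj₁ q = contradiction q ¬pu
    ... | inj₂ (refl , (z , d′) , e′) =
      let j , eq = proj₂ (parents u) (target-parent i e′)
      in _ , by-self {j = j} e (trans e′ (cong (λ z → just (z , d′)) eq))

  -- Legal colours.

  Dangerous : State → V G → Fin 4 → Set
  Dangerous s u c = ∃₂ λ a b → E G a b × (E G u a × s a ≡ just c) × (E G u b × s b ≡ just c)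

  dangerous? : ∀ s u → Decidable (Dangerous s u)
  dangerous? s u c = any? λ a → any? λ b →
    E? G a b ×-dec (E? G u a ×-dec ≡-dec _≟_ (s a) (just c)) ×-dec (E? G u b ×-dec ≡-dec _≟_ (s b) (just c))

  -- A new monochromatic triangle contains `u` exactly once, and its other two corners witness the
  -- danger.
  safe⇒legal : ∀ {s u c} → Legal G 4 s → ¬ Dangerous s u c → Legal G 4 (update {G} s u c)
  safe⇒legal {s} {u} {c} legal safe x y z d xy yz xz ex ey ez
    with update-just G s u c ex | update-just G s u c ey | update-just G s u c ez
  ... | inj₂ sx            | inj₂ sy            | inj₂ sz            = legal x y z d xy yz xz sx sy sz
  ... | inj₁ (refl , refl) | inj₂ sy            | inj₂ sz            = safe (y , z , yz , (xy , sy) , (xz , sz))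
  ... | inj₂ sx            | inj₁ (refl , refl) | inj₂ sz            =
    safe (x , z , xz , (E-sym G xy , sx) , (yz , sz))
  ... | inj₂ sx            | inj₂ sy            | inj₁ (refl , refl) =
    safe (x , y , xy , (E-sym G xz , sx) , (E-sym G yz , sy))
  ... | inj₁ (refl , _)    | inj₁ (refl , _)    | _                  = E-irrefl G xy
  ... | inj₁ (refl , _)    | inj₂ _             | inj₁ (refl , _)    = E-irrefl G xz
  ... | inj₂ _             | inj₁ (refl , _)    | inj₁ (refl , _)    = E-irrefl G yz

  -- Four dangerous colours would need eight coloured neighbours, but there are only seven codes.
  not-all-dangerous : ∀ {s st Pending u} → Inv s st Pending → Unique Pending → Uncoloured s u → ¬ Pending u →
                      ¬ (∀ c → Dangerous s u c)
  not-all-dangerous {s} {u = u} i unique su ¬pu danger = <-irrefl refl (injective⇒≤ {f = code} code-injective)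
    where
    pick : Fin 4 → Fin 2 → V G
    pick c zero    = proj₁ (danger c)
    pick c (suc _) = proj₁ (proj₂ (danger c))

    pick-good : ∀ c j → E G u (pick c j) × s (pick c j) ≡ just c
    pick-good c zero    = let _ , _ , _ , q , _ = danger c in q
    pick-good c (suc _) = let _ , _ , _ , _ , q = danger c in q

    -- A vertex has only one colour, so `c` and `c′` agree; the two picks for one colour differ
    -- because they are adjacent.
    pick-injective : ∀ {c c′} j j′ → pick c j ≡ pick c′ j′ → (c , j) ≡ (c′ , j′)
    pick-injective {c} {c′} j j′ eq
      with refl ← just-injective (trans (≡-sym (proj₂ (pick-good c j))) (trans (cong s eq) (proj₂ (pick-good c′ j′))))
      with j | j′
    ... | zero     | zero     = refl
    ... | suc zero | suc zero = refl
    ... | zero     | suc zero = contradiction eq (E⇒≢ G (proj₁ (proj₂ (proj₂ (danger c)))))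
    ... | suc zero | zero     = contradiction (≡-sym eq) (E⇒≢ G (proj₁ (proj₂ (proj₂ (danger c)))))

    vertex : Fin 8 → V G
    vertex m = let c , j = remQuot {4} 2 m in pick c j

    vertex-good : ∀ m → E G u (vertex m) × s (vertex m) ≡ just (proj₁ (remQuot {4} 2 m))
    vertex-good m = let c , j = remQuot {4} 2 m in pick-good c j

    vertex-coded : ∀ m → ∃ (Coded i unique su ¬pu (vertex m))
    vertex-coded m = coded i unique su ¬pu (proj₁ (vertex-good m)) (proj₂ (vertex-good m))

    vertex≢u : ∀ m → vertex m ≢ u
    vertex≢u m = E⇒≢ G (proj₁ (vertex-good m)) ∘ ≡-sym

    code : Fin 8 → Fin 7
    code m = encode (proj₁ (vertex-coded m))

    code-injective : ∀ {m m′} → code m ≡ code m′ → m ≡ m′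
    code-injective {m} {m′} eq =
      trans (≡-sym (combine-remQuot {4} 2 m)) (trans (cong (λ (c , j) → combine c j) same) (combine-remQuot {4} 2 m′))
      where
      same : remQuot {4} 2 m ≡ remQuot {4} 2 m′
      same = pick-injective _ _ (coded-unique i unique su ¬pu (vertex≢u m) (vertex≢u m′)
        (proj₂ (vertex-coded m)) (subst (Coded i unique su ¬pu (vertex m′)) (≡-sym (encode-injective eq))
                                         (proj₂ (vertex-coded m′))))

  colorable : ∀ {s st Pending u} → Inv s st Pending → Unique Pending → Legal G 4 s → Uncoloured s u → ¬ Pending u →
              ∃ λ c → Legal G 4 (update {G} s u c)
  colorable {s} {u = u} i unique legal su ¬pu =
    let c , safe = ¬∀⟶∃¬ 4 _ (dangerous? s u) (not-all-dangerous i unique su ¬pu) in c , safe⇒legal legal safe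

  -- Playing out the game.

  shrink : ∀ s U v c → (∀ {w} → Uncoloured s w → w ∈ U) → ∀ {w} → Uncoloured (update {G} s v c) w → w ∈ U - v
  shrink s U v c unc sw = let w≢v , sw′ = update-nothing G s v c sw in x∈p∧x≢y⇒x∈p-y (unc sw′) w≢v

  mutual

    -- `U` contains all uncoloured vertices and loses the played vertex in each move, which gives
    -- termination.
    alice-wins : ∀ {s} U → Acc _⊂_ U → (∀ {v} → Uncoloured s v → v ∈ U) → Legal G 4 s → AllColorable G 4 s →
                 Complete G 4 s ⊎ Reply s → AliceWinsA G 4 s
    alice-wins U _ _ _ _ (inj₁ complete) = doneA complete
    alice-wins {s} U (acc rs) unc legal col (inj₂ (y , st , sy , i)) =
      let c , legal′ = col y sy
      in moveA col y c sy legal′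
           (bob-cannot-win (U - y) (rs (x∈p⇒p-x⊂p (unc sy))) (shrink s U y c unc) legal′ (i c))

    bob-cannot-win : ∀ {s st} U → Acc _⊂_ U → (∀ {v} → Uncoloured s v → v ∈ U) → Legal G 4 s → Inv s st None →
                     AliceWinsB G 4 s
    bob-cannot-win {s} {st} U (acc rs) unc legal i =
      -- This also covers a complete colouring, where both premises of `moveB` are vacuous.
      moveB (λ v sv → colorable i (λ ()) legal sv λ ()) λ b c sb legal′ →
        alice-wins (U - b) (rs (x∈p⇒p-x⊂p (unc sb))) (shrink s U b c unc) legal′
          -- Bob's vertex is still pending here; it is coloured, so it is never the vertex `v` in
          -- question.
          (λ v sv → colorable (colour (weaken i) c) (λ { refl refl → refl }) legal′ sv
                             (proj₁ (update-nothing G s b c sv)))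
          (respond (colour (weaken i) c) (update-self G s b c))

theorem3p6 : (H : Graph) → Chordal H → CliqueNumber H 3 → GameChrom2≤ H 4
theorem3p6 H ch (_ , ω≤3) =
  4 , ≤-refl , alice-wins ⊤ (⊂-wellFounded ⊤) (λ _ → ∈⊤) (λ _ _ _ _ _ _ _ ())
    -- Alice opens with a greedy move, as there is no move of Bob to answer.
    (λ v sv → colorable inv-start (λ ()) (λ _ _ _ _ _ _ _ ()) sv λ ()) (greedy inv-start)
  where
  open Ranking (chordal⇒ranking H ch ⊤)
  open Strategy H r (r-inj ∈⊤ ∈⊤) (clique ∈⊤ ∈⊤ ∈⊤) (λ K₄ → <-irrefl refl (ω≤3 4 K₄))
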